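{- Let $G$ be a connected bipartite graph with color classes $X$ and $Y$ that has no universal vertex. Let $\mathbf{H}(G)$ be the transitive reduction of the poset $(\mathcal{B}(G),\preceq)$. Then (the underlying undirected graph of) $\mathbf{H}(G)$ is a tree if and only if $G$ is a bipartite distance hereditary (BDH) graph.
   Context: A universal vertex of a bipartite graph is a vertex adjacent to all vertices of the opposite color class. A biclique of $G$ is a pair $B=(U,W)$ with $U\subseteq X$, $W\subseteq Y$ and every vertex of $U$ adjacent to every vertex of $W$; $X(B)=U$ and $Y(B)=W$ are its shores. A biclique $B$ dominates $B'$ if $X(B')\subseteq X(B)$ and $Y(B')\subseteq Y(B)$; $\mathcal{B}(G)$ is the set of maximal bicliques (inclusion-wise maximal vertex sets inducing complete bipartite subgraphs). The order is $B\preceq B'$ iff $X(B)\subseteq X(B')$ (equivalently $Y(B)\supseteq Y(B')$). The transitive reduction of a poset is the directed graph on its elements with an arc $(x,y)$ iff $y$ covers $x$. A graph $G$ is distance hereditary if for every connected induced subgraph $H$ of $G$ and all $u,v\in V(H)$, $d_H(u,v)=d_G(u,v)$; a BDH graph is a bipartite distance hereditary graph (equivalently, a bipartite graph with no induced cycle of length at least 6 and no induced domino, the domino being $C_6$ plus one chord joining two antipodal vertices). -}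

module Defs where

open import Data.Nat using (ℕ; zero; suc; _≤_)
open import Data.Bool using (Bool; T)
open import Data.Fin using (Fin)
open import Data.Fin.Subset using (Subset; _∈_; _⊆_; Nonempty)
open import Data.Sum using (_⊎_; inj₁; inj₂)
open import Data.Product using (Σ; ∃; _×_)
open import Data.Unit using (⊤)
open import Data.Empty using (⊥)
open import Data.List using (List; length; _++_; take)
open import Data.List.Relation.Unary.All using (All)
open import Data.List.Relation.Unary.Linked using (Linked)
open import Data.List.Relation.Unary.Unique.Propositional using (Unique)
open import Relation.Nullary using (¬_)
open import Relation.Binary.PropositionalEquality using (_≡_)

data Walk {V : Set} (In : V → Set) (Adj : V → V → Set) : V → V → ℕ → Set where
  here : ∀ {u} → In u → Walk In Adj u u 0
  step : ∀ {u w v k} → In u → Adj u w → Walk In Adj w v k → Walk In Adj u v (suc k)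

Connected : {V : Set} → (V → Set) → (V → V → Set) → Set
Connected {V} In Adj = ∀ (u v : V) → In u → In v → Σ ℕ (Walk In Adj u v)

IsDist : {V : Set} → (V → Set) → (V → V → Set) → V → V → ℕ → Set
IsDist In Adj u v d = Walk In Adj u v d × (∀ k → Walk In Adj u v k → d ≤ k)

HasCycle : {V : Set} → (V → Set) → (V → V → Set) → Set
HasCycle {V} In Adj =
  Σ (List V) λ cs → (3 ≤ length cs) × Unique cs × All In cs × Linked Adj (cs ++ take 1 cs)

IsTree : {V : Set} → (V → Set) → (V → V → Set) → Set
IsTree {V} In Adj = (Σ V In) × Connected In Adj × ¬ HasCycle In Adj

-- Bipartite graph with colour classes X = Fin m, Y = Fin n, edges E x y.

Vtx : ℕ → ℕ → Set
Vtx m n = Fin m ⊎ Fin n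

Adj : ∀ {m n} → (Fin m → Fin n → Bool) → Vtx m n → Vtx m n → Set
Adj E (inj₁ x) (inj₂ y) = T (E x y)
Adj E (inj₂ y) (inj₁ x) = T (E x y)
Adj E (inj₁ _) (inj₁ _) = ⊥
Adj E (inj₂ _) (inj₂ _) = ⊥

All⊤ : ∀ {m n} → Vtx m n → Set
All⊤ _ = ⊤

GConnected : ∀ {m n} → (Fin m → Fin n → Bool) → Set
GConnected E = Connected All⊤ (Adj E)

HasUniversal : ∀ {m n} → (Fin m → Fin n → Bool) → Set
HasUniversal {m} {n} E =
  (Σ (Fin m) λ x → ∀ (y : Fin n) → T (E x y)) ⊎ (Σ (Fin n) λ y → ∀ (x : Fin m) → T (E x y))

Bic : ℕ → ℕ → Set
Bic m n = Subset m × Subset n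

X : ∀ {m n} → Bic m n → Subset m
X = Data.Product.proj₁

Y : ∀ {m n} → Bic m n → Subset n
Y = Data.Product.proj₂

IsBiclique : ∀ {m n} → (Fin m → Fin n → Bool) → Bic m n → Set
IsBiclique E B =
  Nonempty (X B) × Nonempty (Y B) × (∀ x y → x ∈ X B → y ∈ Y B → T (E x y))

Dominates : ∀ {m n} → Bic m n → Bic m n → Set
Dominates B B' = (X B' ⊆ X B) × (Y B' ⊆ Y B)

IsMaxBiclique : ∀ {m n} → (Fin m → Fin n → Bool) → Bic m n → Set
IsMaxBiclique E B = IsBiclique E B × (∀ B' → IsBiclique E B' → Dominates B' B → B' ≡ B)

_⪯_ : ∀ {m n} → Bic m n → Bic m n → Set
B ⪯ B' = X B ⊆ X B'

Covers : ∀ {m n} → (Fin m → Fin n → Bool) → Bic m n → Bic m n → Set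
Covers E B B' =
  (B ⪯ B') × ¬ (B ≡ B') ×
  (∀ C → IsMaxBiclique E C → B ⪯ C → C ⪯ B' → ¬ (C ≡ B) → ¬ (C ≡ B') → ⊥)

-- Underlying undirected graph of the transitive reduction H(G):
-- vertices = maximal bicliques, edges = cover pairs (either direction).
HAdj : ∀ {m n} → (Fin m → Fin n → Bool) → Bic m n → Bic m n → Set
HAdj E B B' = Covers E B B' ⊎ Covers E B' B

InS : ∀ {m n} → (Vtx m n → Bool) → Vtx m n → Set
InS S v = T (S v)

IsBDH : ∀ {m n} → (Fin m → Fin n → Bool) → Set
IsBDH {m} {n} E =
  ∀ (S : Vtx m n → Bool) → Connected (InS S) (Adj E) →
  ∀ u v → T (S u) → T (S v) → ∀ d →
  (IsDist (InS S) (Adj E) u v d → IsDist All⊤ (Adj E) u v d) ×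
  (IsDist All⊤ (Adj E) u v d → IsDist (InS S) (Adj E) u v d)

{-# OPTIONS --safe #-}

-- Both directions go through the claim that, for a cover B ⋖ C, removing the edges of
-- X(B) × Y(C) from G leaves no path from X(B) to Y(C).  This is the statement that the edge BC
-- of H(G) is a bridge, since an edge xy of G corresponds to a chain of covers from the least
-- biclique containing x to the greatest one containing y, which uses BC iff x ∈ X(B), y ∈ Y(C).
--
-- If G is BDH, a path from X(B) to Y(C) left over could be shortened to x y z w with
-- y ∉ Y(C) and z ∉ X(B).  If y ∈ Y(B) and z ∈ X(C), the biclique generated by Y(C) ∪ {y} lies
-- strictly between B and C; otherwise x y z w extends to an induced domino.
--
-- If H(G) is a tree, every induced path a b c d admits a cover whose cut separates {a, b}
-- from {c, d}.  For an induced path a b c d … v, any walk in G from a to v then crosses this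
-- cut on an edge w w′ with w adjacent to c and b adjacent to w′; as w ≠ a, induction applied
-- to b c d … v bounds its length from below.
module Submission where

open import Defs
open import Data.Nat using (ℕ)
open import Data.Bool using (Bool)
open import Data.Fin using (Fin)
open import Data.Sum using (_⊎_)
open import Relation.Nullary using (¬_)
open import Function.Bundles using (_⇔_)

open import Data.Bool using (T; true)
open import Data.Bool.Properties using (T?) renaming (_≟_ to _≟ᵇ_)
open import Data.Empty using (⊥; ⊥-elim)
open import Data.Fin.Properties using (all?; any?) renaming (_≟_ to _≟ᶠ_)
open import Data.Fin.Subset using (Subset; _∈_; _∉_; _⊆_; _⊈_; _⊂_; _∪_; ⁅_⁆; ∣_∣; Nonempty)
open import Data.Fin.Subset.Properties
  using (_∈?_; nonempty?; anySubset?; _⊆?_; _⊂?_; ⊆-antisym; ⊆-trans; p⊂q⇒∣p∣<∣q∣;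
         x∈p∪q⁺; x∈p∪q⁻; x∈⁅x⁆; x∈⁅y⁆⇒x≡y)
open import Data.List using (List; []; _∷_; _++_)
import Data.List.Membership.DecPropositional as DecMembership
open import Data.List.Membership.Propositional using () renaming (_∈_ to _∈ᴸ_)
open import Data.List.Relation.Unary.All using (All; []; _∷_; lookup)
open import Data.List.Relation.Unary.All.Properties using (¬Any⇒All¬)
open import Data.List.Relation.Unary.AllPairs using ([]; _∷_)
open import Data.List.Relation.Unary.Any using (here; there)
open import Data.List.Relation.Unary.Linked using (Linked; [-]; _∷_)
open import Data.List.Relation.Unary.Unique.Propositional using (Unique)
open import Data.Nat using (zero; suc; _+_; _≤_; _<_; z≤n; s≤s)
open import Data.Nat.Properties
  using (≤-trans; ≤-antisym; ≤-pred; m≤n+m; n≮n; n≤1+n; +-identityʳ; +-suc; +-monoˡ-≤)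
open import Data.Product using (Σ; ∃; ∃-syntax; _×_; _,_; proj₁; proj₂)
import Data.Product.Properties as Product
open import Data.Sum using (inj₁; inj₂; [_,_]′)
import Data.Sum.Properties as Sum
open import Data.Unit using (tt)
open import Data.Vec using (tabulate)
open import Data.Vec.Properties using (lookup∘tabulate; lookup⇒[]=; []=⇒lookup) renaming (≡-dec to ≡-decᵛ)
open import Function using (_∘_; flip; id)
open import Function.Bundles using (mk⇔; Equivalence)
open import Relation.Binary.Definitions using (DecidableEquality; Symmetric)
open import Relation.Binary.PropositionalEquality using (_≡_; _≢_; refl; sym; trans; cong; cong₂; subst)
open import Relation.Nullary using (Dec; yes; no; contradiction; does)
open import Relation.Nullary.Decidable
  using (map′; _×-dec_; _⊎-dec_; _→-dec_; ¬?; ⌊_⌋; toWitness; fromWitness; dec-true; decidable-stable)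
open import Relation.Unary using (Decidable)

-- Walks

module _ {V : Set} (In : V → Set) (R : V → V → Set) where

  Reach : V → V → Set
  Reach u v = Σ ℕ (Walk In R u v)

module _ {V : Set} {In : V → Set} {R : V → V → Set} where

  walk-start : ∀ {u v k} → Walk In R u v k → In u
  walk-start (here p)     = p
  walk-start (step p _ _) = p

  reach-refl : ∀ {u} → In u → Reach In R u u
  reach-refl p = 0 , here p

  reach-step : ∀ {u w v} → In u → R u w → Reach In R w v → Reach In R u v
  reach-step p r (_ , w) = _ , step p r w

  walk-append : ∀ {u v w k} → Walk In R u v k → Reach In R v w → Reach In R u w
  walk-append (here _)      q = q
  walk-append (step p r ws) q = reach-step p r (walk-append ws q)

  reach-trans : ∀ {u v w} → Reach In R u v → Reach In R v w → Reach In R u w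
  reach-trans (_ , p) q = walk-append p q

  walk-reverse : Symmetric R → ∀ {u v k} → Walk In R u v k → Reach In R v u
  walk-reverse R-sym (here p)     = reach-refl p
  walk-reverse R-sym (step p r w) =
    reach-trans (walk-reverse R-sym w) (reach-step (walk-start w) (R-sym r) (reach-refl p))

  reach-sym : Symmetric R → ∀ {u v} → Reach In R u v → Reach In R v u
  reach-sym R-sym (_ , w) = walk-reverse R-sym w

  vertices : ∀ {u v k} → Walk In R u v k → List V
  vertices {u} (here _)     = u ∷ []
  vertices {u} (step _ _ w) = u ∷ vertices w

  start∈vertices : ∀ {u v k} (w : Walk In R u v k) → u ∈ᴸ vertices w
  start∈vertices (here _)     = here refl
  start∈vertices (step _ _ _) = here refl

  end∈vertices : ∀ {u v k} (w : Walk In R u v k) → v ∈ᴸ vertices w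
  end∈vertices (here _)     = here refl
  end∈vertices (step _ _ w) = there (end∈vertices w)

  vertices-In : ∀ {u v k} (w : Walk In R u v k) → All In (vertices w)
  vertices-In (here p)     = p ∷ []
  vertices-In (step p _ w) = p ∷ vertices-In w

module _ {V : Set} {In In′ : V → Set} {R : V → V → Set} where

  -- `In′` need only hold along the walk, so the vertices of a walk induce a connected subgraph.
  reach-end : ∀ {u v k} (w : Walk In R u v k) →
    (∀ {x} → x ∈ᴸ vertices w → In′ x) → ∀ {x} → x ∈ᴸ vertices w → Reach In′ R x v
  reach-end (here _)     f (here refl) = reach-refl (f (here refl))
  reach-end (step _ r w) f (here refl) =
    reach-step (f (here refl)) r (reach-end w (f ∘ there) (start∈vertices w))
  reach-end (step _ r w) f (there x∈)  = reach-end w (f ∘ there) x∈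

walk-map : {V : Set} {In In′ : V → Set} {R R′ : V → V → Set} →
  (∀ {v} → In v → In′ v) → (∀ {v w} → R v w → R′ v w) →
  ∀ {u v k} → Walk In R u v k → Walk In′ R′ u v k
walk-map f g (here p)     = here (f p)
walk-map f g (step p r w) = step (f p) (g r) (walk-map f g w)

-- Indexed by the vertex list rather than the length, so that distinctness can be stated and the
-- list passed to `HasCycle`.
data Path {V : Set} (In : V → Set) (R : V → V → Set) : V → V → List V → Set where
  [_] : ∀ {u} → In u → Path In R u u (u ∷ [])
  _∷⟨_⟩_ : ∀ {u w v vs} → In u → R u w → Path In R w v vs → Path In R u v (u ∷ vs)

module _ {V : Set} {In : V → Set} {R : V → V → Set} where

  path-In : ∀ {u v vs} → Path In R u v vs → All In vs
  path-In [ p ]          = p ∷ []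
  path-In (p ∷⟨ _ ⟩ π) = p ∷ path-In π

  path-linked : ∀ {R′ : V → V → Set} → (∀ {x y} → R x y → R′ x y) →
    ∀ {u v w vs} → Path In R u v vs → R′ v w → Linked R′ (vs ++ w ∷ [])
  path-linked f [ _ ]                        s = s ∷ [-]
  path-linked f (_ ∷⟨ r ⟩ π@([ _ ]))         s = f r ∷ path-linked f π s
  path-linked f (_ ∷⟨ r ⟩ π@(_ ∷⟨ _ ⟩ _))   s = f r ∷ path-linked f π s

  path-suffix : ∀ {u v x vs} → Path In R u v vs → Unique vs → x ∈ᴸ vs →
    ∃[ us ] Path In R x v us × Unique us
  path-suffix π            uniq       (here refl) with π
  ... | [ p ]        = _ , [ p ] , uniq
  ... | p ∷⟨ r ⟩ π′ = _ , p ∷⟨ r ⟩ π′ , uniq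
  path-suffix (_ ∷⟨ _ ⟩ π) (_ ∷ uniq) (there x∈)  = path-suffix π uniq x∈

  walk⇒path : DecidableEquality V → ∀ {u v k} → Walk In R u v k →
    ∃[ vs ] Path In R u v vs × Unique vs
  walk⇒path _≟_ (here p) = _ , [ p ] , [] ∷ []
  walk⇒path _≟_ {u} (step p r w) with walk⇒path _≟_ w
  ... | vs , π , uniq with DecMembership._∈?_ _≟_ u vs
  ...   | yes u∈ = path-suffix π uniq u∈
  ...   | no  u∉ = _ , p ∷⟨ r ⟩ π , ¬Any⇒All¬ vs u∉ ∷ uniq

  -- A duplicate-free path from `p` to `q` has a third vertex, so the edge from `q` back to `p`
  -- closes it.
  detour⇒cycle : DecidableEquality V → ∀ {R′ : V → V → Set} → (∀ {x y} → R x y → R′ x y) →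
    ∀ {p q} → p ≢ q → ¬ R p q → R′ q p → Reach In R p q → HasCycle In R′
  detour⇒cycle _≟_ f p≢q ¬pq qp (_ , w) with walk⇒path _≟_ w
  ... | _ , [ _ ]              , _    = contradiction refl p≢q
  ... | _ , (_ ∷⟨ r ⟩ [ _ ]) , _    = contradiction r ¬pq
  ... | _ , π@(_ ∷⟨ _ ⟩ (_ ∷⟨ _ ⟩ [ _ ])) , uniq =
    _ , s≤s (s≤s (s≤s z≤n)) , uniq , path-In π , path-linked f π qp
  ... | _ , π@(_ ∷⟨ _ ⟩ (_ ∷⟨ _ ⟩ (_ ∷⟨ _ ⟩ _))) , uniq =
    _ , s≤s (s≤s (s≤s z≤n)) , uniq , path-In π , path-linked f π qp

-- Edge cuts

-- Used twice: on G with the edges of X(B) × Y(C) removed, and on H(G) with the single edge BC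
-- removed.
module EdgeCut {V : Set} (In : V → Set) (R : V → V → Set) (R-sym : Symmetric R)
  (P Q : V → Set) (P? : Decidable P) (Q? : Decidable Q) where

  Removed Kept : V → V → Set
  Removed v w = (P v × Q w) ⊎ (Q v × P w)
  Kept v w = R v w × ¬ Removed v w

  removed? : ∀ v w → Dec (Removed v w)
  removed? v w = (P? v ×-dec Q? w) ⊎-dec (Q? v ×-dec P? w)

  kept-sym : Symmetric Kept
  kept-sym (r , ¬rem) = R-sym r , ¬rem ∘ λ where
    (inj₁ (p , q)) → inj₂ (q , p)
    (inj₂ (q , p)) → inj₁ (p , q)

  Near : (V → Set) → V → Set
  Near S v = ∃[ t ] S t × Reach In Kept v t

  near-refl : ∀ {S v} → In v → S v → Near S v
  near-refl i s = _ , s , reach-refl i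

  near-step : ∀ {S v w} → In v → Kept v w → Near S w → Near S v
  near-step i r (t , s , ws) = t , s , reach-step i r ws

  -- Along a walk into `P`, the kept edges before the first removed one lead to an end of that edge,
  -- which lies in `P` or `Q`.
  near-either : ∀ {v t k} → Walk In R v t k → P t → Near P v ⊎ Near Q v
  near-either (here i) p = inj₁ (near-refl i p)
  near-either {v} (step {w = w} i r ws) p with removed? v w
  ... | yes (inj₁ (pv , _)) = inj₁ (near-refl i pv)
  ... | yes (inj₂ (qv , _)) = inj₂ (near-refl i qv)
  ... | no ¬rem = [ inj₁ ∘ near-step i (r , ¬rem) , inj₂ ∘ near-step i (r , ¬rem) ]′ (near-either ws p)

  module Separated (sep : ∀ {p q} → P p → Q q → ¬ Reach In Kept p q) where

    near-disjoint : ∀ {v} → Near P v → ¬ Near Q v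
    near-disjoint (_ , p , r) (_ , q , s) = sep p q (reach-trans (reach-sym kept-sym r) s)

    -- A kept edge would join the two sides, and so would an end `v` lying in `Q`.
    crossing : ∀ {v w} → In v → R v w → Near P v → Near Q w → P v × Q w
    crossing {v} {w} i r nearP nearQ with removed? v w
    ... | yes (inj₁ pq)       = pq
    ... | yes (inj₂ (qv , _)) = ⊥-elim (near-disjoint nearP (near-refl i qv))
    ... | no ¬rem             = ⊥-elim (near-disjoint nearP (near-step i (r , ¬rem) nearQ))

-- The rest of a cycle starting with the edge c₀ c₁ would cross from A back to A′ on an edge
-- other than c₁ c₀.
module _ {V : Set} {In : V → Set} {R : V → V → Set} {A A′ : V → Set} {c₀ c₁ : V}
  (either : ∀ {v} → In v → A v ⊎ A′ v)
  (cross : ∀ {v w} → In v → In w → R v w → A v → A′ w → v ≡ c₁ × w ≡ c₀)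
  (c₀-In : In c₀) (c₀-A′ : A′ c₀) where

  no-return : ∀ {v} vs → All (c₁ ≢_) (v ∷ vs) → All In (v ∷ vs) →
    Linked R ((v ∷ vs) ++ c₀ ∷ []) → ¬ A v
  no-return []       (c₁≢v ∷ _) (i ∷ _) (r ∷ _) a = c₁≢v (sym (proj₁ (cross i c₀-In r a c₀-A′)))
  no-return (w ∷ vs) (c₁≢v ∷ c₁≢) (i ∷ is@(j ∷ _)) (r ∷ rs) a with either j
  ... | inj₁ aw = no-return vs c₁≢ is rs aw
  ... | inj₂ bw = c₁≢v (sym (proj₁ (cross i j r a bw)))

  no-cycle-through : ∀ {c₂} cs → Unique (c₀ ∷ c₁ ∷ c₂ ∷ cs) → All In (c₁ ∷ c₂ ∷ cs) →
    Linked R ((c₁ ∷ c₂ ∷ cs) ++ c₀ ∷ []) → ¬ A c₁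
  no-cycle-through cs ((_ ∷ c₀≢c₂ ∷ _) ∷ c₁≢ ∷ _) (i ∷ is@(j ∷ _)) (r ∷ rs) a with either j
  ... | inj₁ aw = no-return cs c₁≢ is rs aw
  ... | inj₂ bw = c₀≢c₂ (sym (proj₂ (cross i j r a bw)))

-- Finite searches

least : ∀ {P : ℕ → Set} → Decidable P → ∀ {k} → P k → ∃[ d ] P d × (∀ j → P j → d ≤ j)
least P? {k} p with P? 0
... | yes p₀ = 0 , p₀ , λ _ _ → z≤n
least P? {zero}  p | no ¬p₀ = contradiction p ¬p₀
least P? {suc k} p | no ¬p₀ with least (P? ∘ suc) p
... | d , pd , d-min = suc d , pd , λ where
  zero    p₀ → contradiction p₀ ¬p₀
  (suc j) pj → s≤s (d-min j pj)

⊈⇒∃∉ : ∀ {n} {p q : Subset n} → p ⊈ q → ∃[ x ] x ∈ p × x ∉ q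
⊈⇒∃∉ {n} {p} {q} p⊈q with any? (λ x → (x ∈? p) ×-dec ¬? (x ∈? q))
... | yes found = found
... | no none   = ⊥-elim (p⊈q included)
  where
  included : p ⊆ q
  included {x} x∈p = decidable-stable (x ∈? q) (λ x∉q → none (x , x∈p , x∉q))

singleton-elim : ∀ {n} {P : Fin n → Set} {x} → P x → ∀ x′ → x′ ∈ ⁅ x ⁆ → P x′
singleton-elim {P = P} p x′ x′∈ = subst P (sym (x∈⁅y⁆⇒x≡y _ x′∈)) p

-- Common neighbourhoods and maximal bicliques

module _ {a b : ℕ} (F : Fin a → Fin b → Bool) where

  adjacent? : ∀ U y → Dec (∀ x → x ∈ U → T (F x y))
  adjacent? U y = all? (λ x → (x ∈? U) →-dec T? (F x y))

  abstract
    common : Subset a → Subset b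
    common U = tabulate (λ y → does (adjacent? U y))

    ∈common⇔ : ∀ {U y} → y ∈ common U ⇔ (∀ x → x ∈ U → T (F x y))
    ∈common⇔ {U} {y} = mk⇔
      (λ y∈ → does⇒ (adjacent? U y) (trans (sym (lookup∘tabulate _ y)) ([]=⇒lookup y∈)))
      (λ f → lookup⇒[]= y _ (trans (lookup∘tabulate _ y) (dec-true (adjacent? U y) f)))
      where
      does⇒ : ∀ {A : Set} (a? : Dec A) → does a? ≡ true → A
      does⇒ (yes a) _ = a

module _ {a b : ℕ} {F : Fin a → Fin b → Bool} {U : Subset a} {y : Fin b} where

  common⁺ : (∀ x → x ∈ U → T (F x y)) → y ∈ common F U
  common⁺ = Equivalence.from (∈common⇔ F)

  common⁻ : y ∈ common F U → ∀ x → x ∈ U → T (F x y)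
  common⁻ = Equivalence.to (∈common⇔ F)

  ∉common⇒non-edge : y ∉ common F U → ∃[ x ] x ∈ U × ¬ T (F x y)
  ∉common⇒non-edge y∉ with any? (λ x → (x ∈? U) ×-dec ¬? (T? (F x y)))
  ... | yes found = found
  ... | no none   = contradiction (common⁺ edge) y∉
    where
    edge : ∀ x → x ∈ U → T (F x y)
    edge x x∈ = decidable-stable (T? (F x y)) (λ ¬e → none (x , x∈ , ¬e))

module _ {m n : ℕ} (E : Fin m → Fin n → Bool) where

  comX : Subset n → Subset m
  comX = common (flip E)

  comY : Subset m → Subset n
  comY = common E

  -- The Galois closure of `W`: when its shores are nonempty, the ⪯-greatest biclique whose Y-shore
  -- contains `W`.
  closure : Subset n → Bic m n
  closure W = comX W , comY (comX W)

module _ {m n : ℕ} {E : Fin m → Fin n → Bool} where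

  ⊆comY∘comX : ∀ {W} → W ⊆ comY E (comX E W)
  ⊆comY∘comX y∈W = common⁺ (λ x x∈ → common⁻ x∈ _ y∈W)

  ⊆comX∘comY : ∀ {U} → U ⊆ comX E (comY E U)
  ⊆comX∘comY x∈U = common⁺ (λ y y∈ → common⁻ y∈ _ x∈U)

  closure-max : ∀ {W} → Nonempty W → Nonempty (comX E W) → IsMaxBiclique E (closure E W)
  closure-max {W} (y , y∈W) ne =
    (ne , (y , ⊆comY∘comX y∈W) , λ x y x∈ y∈ → common⁻ y∈ x x∈) , maximal
    where
    maximal : ∀ B → IsBiclique E B → Dominates B (closure E W) → B ≡ closure E W
    maximal (U , V) (_ , _ , edge) (X⊆ , Y⊆) = cong₂ _,_
      (⊆-antisym (λ x∈ → common⁺ (λ y y∈W → edge _ _ x∈ (Y⊆ (⊆comY∘comX y∈W)))) X⊆)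
      (⊆-antisym (λ y∈ → common⁺ (λ x x∈ → edge _ _ (X⊆ x∈) y∈)) Y⊆)

  module _ {B : Bic m n} (max : IsMaxBiclique E B) where

    max-edge : ∀ {x y} → x ∈ X B → y ∈ Y B → T (E x y)
    max-edge = proj₂ (proj₂ (proj₁ max)) _ _

    max-nonemptyX : Nonempty (X B)
    max-nonemptyX = proj₁ (proj₁ max)

    max-nonemptyY : Nonempty (Y B)
    max-nonemptyY = proj₁ (proj₂ (proj₁ max))

    -- Enlarging the X-shore to `comX E (Y B)` gives a biclique dominating `B`, hence `B` itself.
    max-X : comX E (Y B) ≡ X B
    max-X = cong X (proj₂ max (comX E (Y B) , Y B)
      ((_ , X⊆ (proj₂ max-nonemptyX)) , max-nonemptyY , λ x y x∈ y∈ → common⁻ x∈ y y∈)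
      (X⊆ , id))
      where
      X⊆ : X B ⊆ comX E (Y B)
      X⊆ x∈ = common⁺ (λ y y∈ → max-edge x∈ y∈)

    max-Y : comY E (X B) ≡ Y B
    max-Y = cong Y (proj₂ max (X B , comY E (X B))
      (max-nonemptyX , (_ , Y⊆ (proj₂ max-nonemptyY)) , λ x y x∈ y∈ → common⁻ y∈ x x∈)
      (id , Y⊆))
      where
      Y⊆ : Y B ⊆ comY E (X B)
      Y⊆ y∈ = common⁺ (λ x x∈ → max-edge x∈ y∈)

    ∈X⁺ : ∀ {x} → (∀ y → y ∈ Y B → T (E x y)) → x ∈ X B
    ∈X⁺ {x} f = subst (x ∈_) max-X (common⁺ f)

    ∈Y⁺ : ∀ {y} → (∀ x → x ∈ X B → T (E x y)) → y ∈ Y B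
    ∈Y⁺ {y} f = subst (y ∈_) max-Y (common⁺ f)

    ∉X⇒non-edge : ∀ {x} → x ∉ X B → ∃[ y ] y ∈ Y B × ¬ T (E x y)
    ∉X⇒non-edge {x} x∉ = ∉common⇒non-edge (x∉ ∘ subst (x ∈_) max-X)

    ∉Y⇒non-edge : ∀ {y} → y ∉ Y B → ∃[ x ] x ∈ X B × ¬ T (E x y)
    ∉Y⇒non-edge {y} y∉ = ∉common⇒non-edge (y∉ ∘ subst (y ∈_) max-Y)

  ⪯⇒Y⊇ : ∀ {B C} → IsMaxBiclique E B → IsMaxBiclique E C → B ⪯ C → Y C ⊆ Y B
  ⪯⇒Y⊇ maxB maxC B⪯C y∈ = ∈Y⁺ maxB (λ x x∈ → max-edge maxC (B⪯C x∈) y∈)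

  Y⊇⇒⪯ : ∀ {B C} → IsMaxBiclique E B → IsMaxBiclique E C → Y C ⊆ Y B → B ⪯ C
  Y⊇⇒⪯ maxB maxC Y⊇ x∈ = ∈X⁺ maxC (λ y y∈ → max-edge maxB x∈ (Y⊇ y∈))

  ⪯-antisym : ∀ {B C} → IsMaxBiclique E B → IsMaxBiclique E C → B ⪯ C → C ⪯ B → B ≡ C
  ⪯-antisym maxB maxC B⪯C C⪯B =
    cong₂ _,_ (⊆-antisym B⪯C C⪯B) (⊆-antisym (⪯⇒Y⊇ maxC maxB C⪯B) (⪯⇒Y⊇ maxB maxC B⪯C))

  cover-strict : ∀ {B C} → IsMaxBiclique E B → IsMaxBiclique E C → Covers E B C → ¬ C ⪯ B
  cover-strict maxB maxC (B⪯C , B≢C , _) C⪯B = B≢C (⪯-antisym maxB maxC B⪯C C⪯B)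

  HAdj-sym : Symmetric (HAdj E)
  HAdj-sym = [ inj₂ , inj₁ ]′

_≟ⱽ_ : ∀ {m n} → DecidableEquality (Vtx m n)
_≟ⱽ_ = Sum.≡-dec _≟ᶠ_ _≟ᶠ_

_≟ᴮ_ : ∀ {m n} → DecidableEquality (Bic m n)
_≟ᴮ_ = Product.≡-dec (≡-decᵛ _≟ᵇ_) (≡-decᵛ _≟ᵇ_)

-- Saturated chains of maximal bicliques

data Chain {m n} (E : Fin m → Fin n → Bool) : Bic m n → Bic m n → Set where
  [_] : ∀ {B} → IsMaxBiclique E B → Chain E B B
  _∷⟨_⟩_ : ∀ {B D C} → IsMaxBiclique E B → Covers E B D → Chain E D C → Chain E B C

module _ {m n : ℕ} {E : Fin m → Fin n → Bool} where

  chain-start : ∀ {B C} → Chain E B C → IsMaxBiclique E B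
  chain-start [ max ]          = max
  chain-start (max ∷⟨ _ ⟩ _) = max

  chain-⪯ : ∀ {B C} → Chain E B C → B ⪯ C
  chain-⪯ [ _ ]                     = id
  chain-⪯ (_ ∷⟨ B⪯D , _ ⟩ chain) = chain-⪯ chain ∘ B⪯D

  chain-append : ∀ {B D C} → Chain E B D → Chain E D C → Chain E B C
  chain-append [ _ ]              ds = ds
  chain-append (max ∷⟨ c ⟩ cs) ds = max ∷⟨ c ⟩ chain-append cs ds

  chain-reach : ∀ {B C} → Chain E B C → Reach (IsMaxBiclique E) (HAdj E) B C
  chain-reach [ max ]           = reach-refl max
  chain-reach (max ∷⟨ c ⟩ cs) = reach-step max (inj₁ c) (chain-reach cs)

  chain-cover : ∀ {B C} → Chain E B C → B ≢ C → ∃[ D ] IsMaxBiclique E D × Covers E B D × D ⪯ C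
  chain-cover [ _ ]           B≢C = contradiction refl B≢C
  chain-cover (_ ∷⟨ c ⟩ cs) _   = _ , chain-start cs , c , chain-⪯ cs

  -- Induction on a bound `k` for the gap between the sizes of the X-shores: a biclique strictly in
  -- between splits the gap into two smaller ones.
  ⪯⇒chain-bounded : ∀ k {B C} → IsMaxBiclique E B → IsMaxBiclique E C → B ⪯ C →
    ∣ X C ∣ ≤ ∣ X B ∣ + k → Chain E B C
  ⪯⇒chain-bounded k {B} {C} maxB maxC B⪯C bound with X C ⊆? X B
  ... | yes C⪯B = subst (Chain E B) (⪯-antisym maxB maxC B⪯C C⪯B) [ maxB ]
  -- Each maximal biclique is the closure of its own Y-shore, so searching subsets `W` finds any
  -- that lies in between.
  ... | no  C⋠B with anySubset? (λ W → nonempty? W ×-dec (X B ⊂? comX E W) ×-dec (comX E W ⊂? X C))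
  ⪯⇒chain-bounded k {B} {C} maxB maxC B⪯C bound | no C⋠B | no none =
    maxB ∷⟨ B⪯C , (λ { refl → C⋠B id }) , nothing-between ⟩ [ maxC ]
    where
    strict : ∀ {D D′} → IsMaxBiclique E D → IsMaxBiclique E D′ → D ⪯ D′ → D ≢ D′ → X D ⊂ X D′
    strict maxD maxD′ D⪯D′ D≢D′ = D⪯D′ , ⊈⇒∃∉ (D≢D′ ∘ ⪯-antisym maxD maxD′ D⪯D′)
    nothing-between : ∀ D → IsMaxBiclique E D → B ⪯ D → D ⪯ C → D ≢ B → D ≢ C → ⊥
    nothing-between D maxD B⪯D D⪯C D≢B D≢C = none
      (Y D , max-nonemptyY maxD , subst (λ U → X B ⊂ U × U ⊂ X C) (sym (max-X maxD))
        (strict maxB maxD B⪯D (D≢B ∘ sym) , strict maxD maxC D⪯C D≢C))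
  ⪯⇒chain-bounded zero {B} {C} maxB maxC B⪯C bound | no C⋠B | yes _ =
    contradiction (≤-trans (p⊂q⇒∣p∣<∣q∣ (B⪯C , ⊈⇒∃∉ C⋠B)) (subst (∣ X C ∣ ≤_) (+-identityʳ _) bound)) (n≮n _)
  ⪯⇒chain-bounded (suc k) {B} {C} maxB maxC B⪯C bound | no C⋠B | yes (W , W≢∅ , B⊂W , W⊂C) =
    chain-append
      (⪯⇒chain-bounded k maxB maxD (proj₁ B⊂W)
        (≤-pred (≤-trans (p⊂q⇒∣p∣<∣q∣ W⊂C) (subst (∣ X C ∣ ≤_) (+-suc _ k) bound))))
      (⪯⇒chain-bounded k maxD maxC (proj₁ W⊂C)
        (≤-trans (subst (∣ X C ∣ ≤_) (+-suc _ k) bound) (+-monoˡ-≤ k (p⊂q⇒∣p∣<∣q∣ B⊂W))))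
    where
    maxD : IsMaxBiclique E (closure E W)
    maxD = closure-max W≢∅ (_ , proj₁ B⊂W (proj₂ (max-nonemptyX maxB)))

  ⪯⇒chain : ∀ {B C} → IsMaxBiclique E B → IsMaxBiclique E C → B ⪯ C → Chain E B C
  ⪯⇒chain {B} {C} maxB maxC B⪯C =
    ⪯⇒chain-bounded ∣ X C ∣ maxB maxC B⪯C (m≤n+m _ ∣ X B ∣)

-- Graph walks and distances

module _ {m n : ℕ} {E : Fin m → Fin n → Bool} where

  adj-sym : ∀ u v → Adj E u v → Adj E v u
  adj-sym (inj₁ _) (inj₂ _) e = e
  adj-sym (inj₂ _) (inj₁ _) e = e

  adj? : ∀ u v → Dec (Adj E u v)
  adj? (inj₁ x) (inj₂ y) = T? (E x y)
  adj? (inj₂ y) (inj₁ x) = T? (E x y)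
  adj? (inj₁ _) (inj₁ _) = no id
  adj? (inj₂ _) (inj₂ _) = no id

  triangle-free : ∀ u v w → Adj E u v → Adj E v w → ¬ Adj E u w
  triangle-free (inj₁ _) (inj₂ _) (inj₁ _) _ _ ()
  triangle-free (inj₂ _) (inj₁ _) (inj₂ _) _ _ ()

  walk? : ∀ {In : Vtx m n → Set} → Decidable In → ∀ u v → Decidable (Walk In (Adj E) u v)
  walk? In? u v zero with In? u | u ≟ⱽ v
  ... | yes i | yes refl = yes (here i)
  ... | no ¬i | _        = no λ { (here i) → ¬i i }
  ... | _     | no u≢v   = no λ { (here _) → u≢v refl }
  walk? In? u v (suc k) = map′ build split (In? u ×-dec anyⱽ?)
    where
    Via : Vtx m n → Set
    Via w = Adj E u w × Walk _ (Adj E) w v k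
    via? : Decidable Via
    via? w = adj? u w ×-dec walk? In? w v k
    anyⱽ? : Dec (∃ Via)
    anyⱽ? = map′ [ (λ (x , p) → inj₁ x , p) , (λ (y , p) → inj₂ y , p) ]′
      (λ { (inj₁ x , p) → inj₁ (x , p) ; (inj₂ y , p) → inj₂ (y , p) })
      (any? (via? ∘ inj₁) ⊎-dec any? (via? ∘ inj₂))
    build : _ × ∃ Via → Walk _ (Adj E) u v (suc k)
    build (i , _ , e , ws) = step i e ws
    split : Walk _ (Adj E) u v (suc k) → _ × ∃ Via
    split (step i e ws) = i , _ , e , ws

  -- The vertices of the walk induce a connected subgraph. Through `c` the distance from `u` to `v`
  -- in G is two, so it is two in this subgraph as well.
  common-neighbour : IsBDH E → ∀ {In : Vtx m n → Set} {u c v k} → Walk In (Adj E) u v k →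
    u ≢ v → Adj E u c → Adj E c v → ∃[ z ] In z × Adj E u z × Adj E z v
  common-neighbour bdh {In} {u} {c} {v} w u≢v uc cv
    with proj₁ (proj₂ (bdh S S-connected u v (in-S (start∈vertices w)) (in-S (end∈vertices w)) 2) distance-2)
    where
    open DecMembership _≟ⱽ_ using () renaming (_∈?_ to _∈ᴸ?_)
    S : Vtx m n → Bool
    S x = ⌊ x ∈ᴸ? vertices w ⌋
    in-S : ∀ {x} → x ∈ᴸ vertices w → T (S x)
    in-S = fromWitness
    S-connected : Connected (InS S) (Adj E)
    S-connected a b a∈ b∈ = reach-trans (reach-end w in-S (toWitness a∈))
      (reach-sym (λ {p} {q} → adj-sym p q) (reach-end w in-S (toWitness b∈)))
    distance-2 : IsDist All⊤ (Adj E) u v 2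
    distance-2 = step tt uc (step tt cv (here tt)) , λ where
      0             (here _)             → contradiction refl u≢v
      1             (step _ uv (here _)) → ⊥-elim (triangle-free u c v uc cv uv)
      (suc (suc _)) _                    → s≤s (s≤s z≤n)
  ... | step _ uz (step z∈ zv (here _)) = _ , lookup (vertices-In w) (toWitness z∈) , uz , zv

  -- The path p₁ … p₅ and h span a 6-cycle whose only possible chord is h p₃.
  domino-free : IsBDH E → ∀ {p₁ p₂ p₃ p₄ p₅} h → p₁ ≢ p₅ →
    Adj E p₁ p₂ → Adj E p₂ p₃ → Adj E p₃ p₄ → Adj E p₄ p₅ →
    ¬ Adj E p₁ p₄ → ¬ Adj E p₂ p₅ → Adj E p₁ h → ¬ Adj E h p₅
  domino-free bdh {p₁} {p₂} {p₃} {p₄} {p₅} h p₁≢p₅ e₁₂ e₂₃ e₃₄ e₄₅ ¬e₁₄ ¬e₂₅ e₁h eh₅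
    -- Via `h` the ends have distance two, so some vertex of the path is a common neighbour of both;
    -- each is ruled out.
    with common-neighbour bdh
      {λ v → v ∈ᴸ p₁ ∷ p₂ ∷ p₃ ∷ p₄ ∷ p₅ ∷ []}
      (step (here refl) e₁₂ (step (there (here refl)) e₂₃ (step (there (there (here refl))) e₃₄
        (step (there (there (there (here refl)))) e₄₅ (here (there (there (there (there (here refl))))))))))
      p₁≢p₅ e₁h eh₅
  ... | _ , here refl                                 , _   , e₁₅ = triangle-free p₁ h p₅ e₁h eh₅ e₁₅
  ... | _ , there (here refl)                         , _   , e₂₅ = ¬e₂₅ e₂₅
  ... | _ , there (there (here refl))                 , e₁₃ , _   = triangle-free p₁ p₂ p₃ e₁₂ e₂₃ e₁₃
  ... | _ , there (there (there (here refl)))         , e₁₄ , _   = ¬e₁₄ e₁₄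
  ... | _ , there (there (there (there (here refl)))) , e₁₅ , _   = triangle-free p₁ h p₅ e₁h eh₅ e₁₅

-- Removing the edges of X(B) × Y(C)

module GraphCut {m n : ℕ} {E : Fin m → Fin n → Bool} {B C : Bic m n}
  (maxB : IsMaxBiclique E B) (maxC : IsMaxBiclique E C) (B⋖C : Covers E B C) where

  InXB InYC : Vtx m n → Set
  InXB = [ _∈ X B , (λ _ → ⊥) ]′
  InYC = [ (λ _ → ⊥) , _∈ Y C ]′

  InXB? : Decidable InXB
  InXB? (inj₁ x) = x ∈? X B
  InXB? (inj₂ _) = no id

  InYC? : Decidable InYC
  InYC? (inj₁ _) = no id
  InYC? (inj₂ y) = y ∈? Y C

  open EdgeCut All⊤ (Adj E) (λ {u} {v} → adj-sym u v) InXB InYC InXB? InYC?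

  B⪯C : B ⪯ C
  B⪯C = proj₁ B⋖C

  YC⊆YB : Y C ⊆ Y B
  YC⊆YB = ⪯⇒Y⊇ maxB maxC B⪯C

  XB×YC : ∀ {x y} → x ∈ X B → y ∈ Y C → T (E x y)
  XB×YC x∈ y∈ = max-edge maxB x∈ (YC⊆YB y∈)

  module _ (bdh : IsBDH E) where

    no-short-detour : ∀ {x z y w} → x ∈ X B → y ∉ Y C → z ∉ X B → w ∈ Y C →
      T (E x y) → T (E z y) → ¬ T (E z w)
    no-short-detour {x} {z} {y} {w} x∈ y∉ z∉ w∈ xy zy zw with y ∈? Y B | z ∈? X C
    ... | yes y∈B | yes z∈C =
      -- `D` differs from `B` by `z` in the X-shore and from `C` by `y` in the Y-shore.
      proj₂ (proj₂ B⋖C) D maxD B⪯D D⪯C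
        (λ D≡B → z∉ (subst (λ F → z ∈ X F) D≡B z∈D))
        (λ D≡C → y∉ (subst (λ F → y ∈ Y F) D≡C (⊆comY∘comX {E = E} y∈W)))
      where
      W : Subset n
      W = Y C ∪ ⁅ y ⁆
      D : Bic m n
      D = closure E W
      y∈W : y ∈ W
      y∈W = x∈p∪q⁺ (inj₂ (x∈⁅x⁆ y))
      ∈D : ∀ {x′} → (∀ y′ → y′ ∈ Y C → T (E x′ y′)) → T (E x′ y) → x′ ∈ X D
      ∈D f e = common⁺ (λ y′ → [ f y′ , singleton-elim e y′ ]′ ∘ x∈p∪q⁻ _ _)
      z∈D : z ∈ X D
      z∈D = ∈D (λ _ → max-edge maxC z∈C) zy
      maxD : IsMaxBiclique E D
      maxD = closure-max (y , y∈W) (z , z∈D)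
      B⪯D : B ⪯ D
      B⪯D u∈ = ∈D (λ _ → XB×YC u∈) (max-edge maxB u∈ y∈B)
      D⪯C : D ⪯ C
      D⪯C u∈ = ∈X⁺ maxC (λ y′ y′∈ → common⁻ u∈ y′ (x∈p∪q⁺ (inj₁ y′∈)))
    ... | no y∉B | _ with ∉Y⇒non-edge maxB y∉B | ∉X⇒non-edge maxB z∉
    ...   | x₂ , x₂∈ , ¬x₂y | y₂ , y₂∈ , ¬zy₂ =
      -- `w` is adjacent to `x₂`, `x` and `z`, the path's vertices of the other colour.
      domino-free bdh {inj₁ x₂} {inj₂ y₂} {inj₁ x} {inj₂ y} {inj₁ z} (inj₂ w)
        (λ { refl → z∉ x₂∈ })
        (max-edge maxB x₂∈ y₂∈) (max-edge maxB x∈ y₂∈) xy zy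
        ¬x₂y ¬zy₂ (XB×YC x₂∈ w∈) zw
    no-short-detour {x} {z} {y} {w} x∈ y∉ z∉ w∈ xy zy zw | yes _ | no z∉C
      with ∉Y⇒non-edge maxC y∉ | ∉X⇒non-edge maxC z∉C
    ...   | x₂ , x₂∈ , ¬x₂y | y₂ , y₂∈ , ¬zy₂ =
      -- The mirror image of the previous case, with colours and the roles of `B` and `C` exchanged;
      -- `x` is now the hub.
      domino-free bdh {inj₂ y₂} {inj₁ x₂} {inj₂ w} {inj₁ z} {inj₂ y} (inj₁ x)
        (λ { refl → y∉ y₂∈ })
        (max-edge maxC x₂∈ y₂∈) (max-edge maxC x₂∈ w∈) zw zy
        ¬zy₂ ¬x₂y (XB×YC x∈ y₂∈) xy

    -- Cutting after the last visit to X(B) leaves a remainder whose vertices, among them the later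
    -- `z`, avoid X(B).
    last-exit : ∀ {v t k} → Walk All⊤ Kept v t k → ¬ InXB t →
      Reach (¬_ ∘ InXB) (Adj E) v t ⊎
      (∃[ u ] ∃[ p ] InXB u × Kept u p × Reach (¬_ ∘ InXB) (Adj E) p t)
    last-exit (here _) t∉ = inj₁ (reach-refl t∉)
    last-exit {v} (step _ vw ws) t∉ with last-exit ws t∉
    ... | inj₂ exit = inj₂ exit
    ... | inj₁ avoiding with InXB? v
    ...   | yes v∈ = inj₂ (v , _ , v∈ , vw , avoiding)
    ...   | no  v∉ = inj₁ (reach-step v∉ (proj₁ vw) avoiding)

    -- After the last exit `x y`, `y` and `w` have the common neighbour `x`. Hence they have another
    -- one, `z`, on the rest of the walk, and `z` lies outside X(B).
    separated : ∀ {p q} → InXB p → InYC q → ¬ Reach All⊤ Kept p q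
    separated {p} {inj₂ w} p∈ w∈ (_ , walk) with last-exit walk id
    ... | inj₁ (_ , avoiding) = walk-start avoiding p∈
    ... | inj₂ (inj₁ x , inj₂ y , x∈ , (xy , ¬removed) , (_ , avoiding))
      with common-neighbour bdh {c = inj₁ x} avoiding
             (λ { refl → ¬removed (inj₁ (x∈ , w∈)) }) xy (XB×YC x∈ w∈)
    ...   | inj₁ z , z∉ , zy , zw = no-short-detour x∈ (λ y∈ → ¬removed (inj₁ (x∈ , y∈))) z∉ w∈ xy zy zw

  -- The two sides of H(G) determined by a cover

  module Sides (bdh : IsBDH E) (connected : GConnected E) where

    open Separated (separated bdh)

    near : ∀ v → Near InXB v ⊎ Near InYC v
    near v with max-nonemptyX maxB
    ... | x , x∈ = near-either (proj₂ (connected v (inj₁ x) tt tt)) x∈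

    -- A maximal biclique may meet both sides of the cut in G; its side is decided by an edge of it
    -- with both ends on one side.
    Side : (Vtx m n → Set) → Bic m n → Set
    Side P D = ∃[ x ] ∃[ y ] x ∈ X D × y ∈ Y D × Near P (inj₁ x) × Near P (inj₂ y)

    forward-edge : ∀ {x y} → T (E x y) → Near InXB (inj₁ x) → Near InYC (inj₂ y) → x ∈ X B × y ∈ Y C
    forward-edge {x} {y} = crossing {inj₁ x} {inj₂ y} tt

    -- Such an edge would be a removed one, which puts `y` into the other colour class.
    no-backward-edge : ∀ {x y} → T (E x y) → Near InYC (inj₁ x) → ¬ Near InXB (inj₂ y)
    no-backward-edge {x} {y} xy x-near y-near = proj₁ (crossing {inj₂ y} {inj₁ x} tt xy y-near x-near)

    -- If an edge of `D` crosses forward, either a vertex of `D` outside X(B) or Y(C) supplies an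
    -- uncrossed edge, or `C` ⪯ `D` ⪯ `B`, which is impossible.
    side : ∀ {D} → IsMaxBiclique E D → Side InXB D ⊎ Side InYC D
    side {D} maxD with max-nonemptyX maxD | max-nonemptyY maxD
    ... | x , x∈ | y , y∈ with near (inj₁ x) | near (inj₂ y)
    ...   | inj₁ nx | inj₁ ny = inj₁ (x , y , x∈ , y∈ , nx , ny)
    ...   | inj₂ nx | inj₂ ny = inj₂ (x , y , x∈ , y∈ , nx , ny)
    ...   | inj₂ nx | inj₁ ny = ⊥-elim (no-backward-edge (max-edge maxD x∈ y∈) nx ny)
    ...   | inj₁ nx | inj₂ ny with X D ⊆? X B
    ...     | no D⋠B with ⊈⇒∃∉ D⋠B
    ...       | x′ , x′∈ , x′∉ with near (inj₁ x′)
    ...         | inj₁ nx′ = contradiction (proj₁ (forward-edge (max-edge maxD x′∈ y∈) nx′ ny)) x′∉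
    ...         | inj₂ nx′ = inj₂ (x′ , y , x′∈ , y∈ , nx′ , ny)
    side {D} maxD | x , x∈ | y , y∈ | inj₁ nx | inj₂ ny | yes D⪯B with Y D ⊆? Y C
    ...     | yes C⪯D = ⊥-elim (cover-strict maxB maxC B⋖C (⊆-trans (Y⊇⇒⪯ maxC maxD C⪯D) D⪯B))
    ...     | no C⋠D with ⊈⇒∃∉ C⋠D
    ...       | y′ , y′∈ , y′∉ with near (inj₂ y′)
    ...         | inj₁ ny′ = inj₁ (x , y′ , x∈ , y′∈ , nx , ny′)
    ...         | inj₂ ny′ = contradiction (proj₂ (forward-edge (max-edge maxD x∈ y′∈) nx ny′)) y′∉

    -- An edge from X(B) to a vertex of Y(B) outside Y(C) survives the cut.
    side-B : Side InXB B
    side-B with max-nonemptyX maxB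
              | ⊈⇒∃∉ (cover-strict maxB maxC B⋖C ∘ Y⊇⇒⪯ maxC maxB)
    ... | x , x∈ | y , y∈ , y∉ =
      x , y , x∈ , y∈ , near-refl tt x∈ ,
      near-step {w = inj₁ x} tt (max-edge maxB x∈ y∈ , λ { (inj₂ (y∈C , _)) → y∉ y∈C }) (near-refl tt x∈)

    side-C : Side InYC C
    side-C with max-nonemptyY maxC | ⊈⇒∃∉ (cover-strict maxB maxC B⋖C)
    ... | y , y∈ | x , x∈ , x∉ =
      x , y , x∈ , y∈ ,
      near-step {w = inj₂ y} tt (max-edge maxC x∈ y∈ , λ { (inj₁ (x∈B , _)) → x∉ x∈B }) (near-refl tt y∈) ,
      near-refl tt y∈

    -- An upward step yields `D` ⪯ `B` ⪯ `C` ⪯ `D′`, and a cover leaves no room for `B` or `C`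
    -- strictly inside. A downward step yields a backward edge of G.
    side-crossing : ∀ {D D′} → IsMaxBiclique E D → IsMaxBiclique E D′ → HAdj E D D′ →
      Side InXB D → Side InYC D′ → D ≡ B × D′ ≡ C
    side-crossing maxD maxD′ (inj₂ (D′⪯D , _)) (_ , _ , _ , y∈ , _ , ny) (_ , _ , x∈ , _ , nx , _) =
      ⊥-elim (no-backward-edge (max-edge maxD (D′⪯D x∈) y∈) nx ny)
    side-crossing {D} {D′} maxD maxD′ (inj₁ (D⪯D′ , _ , no-between))
      (x , y , x∈ , y∈ , nx , ny) (x′ , y′ , x′∈ , y′∈ , nx′ , ny′) = D≡B , D′≡C
      where
      D⪯B : D ⪯ B
      D⪯B {u} u∈ with near (inj₁ u)
      ... | inj₁ nu = proj₁ (forward-edge (max-edge maxD′ (D⪯D′ u∈) y′∈) nu ny′)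
      ... | inj₂ nu = ⊥-elim (no-backward-edge (max-edge maxD u∈ y∈) nu ny)
      C⪯D′ : C ⪯ D′
      C⪯D′ = Y⊇⇒⪯ maxC maxD′ YD′⊆YC
        where
        YD′⊆YC : Y D′ ⊆ Y C
        YD′⊆YC {v} v∈ with near (inj₂ v)
        ... | inj₁ nv = ⊥-elim (no-backward-edge (max-edge maxD′ x′∈ v∈) nx′ nv)
        ... | inj₂ nv = proj₂ (forward-edge (max-edge maxD′ (D⪯D′ x∈) v∈) nx nv)
      D≡B : D ≡ B
      D≡B with B ≟ᴮ D | B ≟ᴮ D′
      ... | yes B≡D | _        = sym B≡D
      ... | no _    | yes refl = ⊥-elim (cover-strict maxB maxC B⋖C C⪯D′)
      ... | no B≢D  | no B≢D′ = ⊥-elim (no-between B maxB D⪯B (⊆-trans B⪯C C⪯D′) B≢D B≢D′)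
      D′≡C : D′ ≡ C
      D′≡C with C ≟ᴮ D′ | C ≟ᴮ D
      ... | yes C≡D′ | _        = sym C≡D′
      ... | no _     | yes refl = ⊥-elim (cover-strict maxB maxC B⋖C D⪯B)
      ... | no C≢D′  | no C≢D   = ⊥-elim (no-between C maxC (⊆-trans D⪯B B⪯C) C⪯D′ C≢D C≢D′)

-- The first edge of the cycle is a cover whose ends lie on different sides, and no other edge of
-- H(G) leads back across.
BDH⇒acyclic : ∀ {m n} {E : Fin m → Fin n → Bool} → GConnected E → IsBDH E →
  ¬ HasCycle (IsMaxBiclique E) (HAdj E)
BDH⇒acyclic conn bdh (_ ∷ []     , s≤s ()       , _)
BDH⇒acyclic conn bdh (_ ∷ _ ∷ [] , s≤s (s≤s ()) , _)
BDH⇒acyclic conn bdh (c₀ ∷ c₁ ∷ c₂ ∷ cs , _ , uniq , max₀ ∷ max₁ ∷ maxs , inj₁ c₀⋖c₁ ∷ linked) =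
  no-cycle-through {A = Side InYC} {A′ = Side InXB}
    ([ inj₂ , inj₁ ]′ ∘ side)
    (λ maxD maxD′ adj sideD sideD′ →
      let D′≡ , D≡ = side-crossing maxD′ maxD (HAdj-sym adj) sideD′ sideD in D≡ , D′≡)
    max₀ side-B cs uniq (max₁ ∷ maxs) linked side-C
  where
  open GraphCut max₀ max₁ c₀⋖c₁
  open Sides bdh conn
BDH⇒acyclic conn bdh (c₀ ∷ c₁ ∷ c₂ ∷ cs , _ , uniq , max₀ ∷ max₁ ∷ maxs , inj₂ c₁⋖c₀ ∷ linked) =
  no-cycle-through {A = Side InXB} {A′ = Side InYC} side side-crossing
    max₀ side-C cs uniq (max₁ ∷ maxs) linked side-B
  where
  open GraphCut max₁ max₀ c₁⋖c₀
  open Sides bdh conn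

-- The bicliques attached to the vertices of G

module Nodes {m n : ℕ} {E : Fin m → Fin n → Bool}
  (neighbour : ∀ v → ∃ (Adj E v)) (connected : GConnected E) where

  -- The ⪯-least maximal biclique containing `x`, and the ⪯-greatest containing `y`.
  node : Vtx m n → Bic m n
  node (inj₁ x) = closure E (comY E ⁅ x ⁆)
  node (inj₂ y) = closure E ⁅ y ⁆

  x∈node : ∀ x → x ∈ X (node (inj₁ x))
  x∈node x = ⊆comX∘comY (x∈⁅x⁆ x)

  y∈node : ∀ y → y ∈ Y (node (inj₂ y))
  y∈node y = ⊆comY∘comX (x∈⁅x⁆ y)

  x∈node-y : ∀ {x y} → T (E x y) → x ∈ X (node (inj₂ y))
  x∈node-y xy = common⁺ (singleton-elim xy)

  node-max : ∀ v → IsMaxBiclique E (node v)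
  node-max (inj₁ x) with neighbour (inj₁ x)
  ... | inj₂ y , xy = closure-max (y , common⁺ (singleton-elim xy)) (x , x∈node x)
  node-max (inj₂ y) with neighbour (inj₂ y)
  ... | inj₁ x , xy = closure-max (y , x∈⁅x⁆ y) (x , x∈node-y xy)

  node-x-least : ∀ {x B} → IsMaxBiclique E B → x ∈ X B → node (inj₁ x) ⪯ B
  node-x-least maxB x∈ u∈ =
    ∈X⁺ maxB (λ y y∈ → common⁻ u∈ y (common⁺ (singleton-elim (max-edge maxB x∈ y∈))))

  node-y-greatest : ∀ {y B} → IsMaxBiclique E B → y ∈ Y B → B ⪯ node (inj₂ y)
  node-y-greatest maxB y∈ u∈ = common⁺ (singleton-elim (max-edge maxB u∈ y∈))

  edge⇒⪯ : ∀ {x y} → T (E x y) → node (inj₁ x) ⪯ node (inj₂ y)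
  edge⇒⪯ {x} {y} xy = node-x-least (node-max (inj₂ y)) (x∈node-y xy)

  HReach : Bic m n → Bic m n → Set
  HReach = Reach (IsMaxBiclique E) (HAdj E)

  ⪯⇒reach : ∀ {B C} → IsMaxBiclique E B → IsMaxBiclique E C → B ⪯ C → HReach B C
  ⪯⇒reach maxB maxC B⪯C = chain-reach (⪯⇒chain maxB maxC B⪯C)

  adj⇒reach : ∀ u v → Adj E u v → HReach (node u) (node v)
  adj⇒reach (inj₁ x) (inj₂ y) e = ⪯⇒reach (node-max (inj₁ x)) (node-max (inj₂ y)) (edge⇒⪯ e)
  adj⇒reach (inj₂ y) (inj₁ x) e = reach-sym HAdj-sym (adj⇒reach (inj₁ x) (inj₂ y) e)

  walk⇒reach : ∀ {u v k} → Walk All⊤ (Adj E) u v k → HReach (node u) (node v)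
  walk⇒reach {u} (here _)             = reach-refl (node-max u)
  walk⇒reach {u} (step {w = w} _ e ws) = reach-trans (adj⇒reach u w e) (walk⇒reach ws)

  -- Each maximal biclique lies above the node of any vertex of its X-shore, and adjacent vertices
  -- have comparable nodes.
  H-connected : Connected (IsMaxBiclique E) (HAdj E)
  H-connected B C maxB maxC with max-nonemptyX maxB | max-nonemptyX maxC
  ... | x , x∈ | x′ , x′∈ = reach-trans
    (reach-sym HAdj-sym (⪯⇒reach (node-max (inj₁ x)) maxB (node-x-least maxB x∈)))
    (reach-trans (walk⇒reach (proj₂ (connected (inj₁ x) (inj₁ x′) tt tt)))
      (⪯⇒reach (node-max (inj₁ x′)) maxC (node-x-least maxC x′∈)))

  -- What the distance argument needs from a cut, stated so that both colourings of `a b c d` are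
  -- treated alike.
  record Split (a b c d : Vtx m n) : Set₁ where
    field
      L R      : Vtx m n → Set
      either   : ∀ v → L v ⊎ R v
      disjoint : ∀ {v} → L v → ¬ R v
      left     : L a
      right    : R d
      cross    : ∀ v w → Adj E v w → L v → R w → Adj E v c × Adj E b w

  -- Cuts of an acyclic H(G) and the cuts they induce on G

  module _ (acyclic : ¬ HasCycle (IsMaxBiclique E) (HAdj E)) where

    module CoverCut {B C : Bic m n}
      (maxB : IsMaxBiclique E B) (maxC : IsMaxBiclique E C) (B⋖C : Covers E B C) where

      open EdgeCut (IsMaxBiclique E) (HAdj E) HAdj-sym (_≡ B) (_≡ C) (_≟ᴮ B) (_≟ᴮ C)

      separated : ∀ {p q} → p ≡ B → q ≡ C → ¬ Reach (IsMaxBiclique E) Kept p q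
      separated refl refl detour = acyclic
        (detour⇒cycle _≟ᴮ_ proj₁ (proj₁ (proj₂ B⋖C)) (λ (_ , ¬removed) → ¬removed (inj₁ (refl , refl)))
          (inj₂ B⋖C) detour)

      open Separated separated public using (near-disjoint)
      open Separated separated using (crossing)

      -- The first step onto the side of `C` must be the edge BC itself.
      chain-up : ∀ {D D′} → Chain E D D′ → Near (_≡ B) D → Near (_≡ C) D′ → D ⪯ B × C ⪯ D′
      chain-up [ _ ] nB nC = ⊥-elim (near-disjoint nB nC)
      chain-up (maxD ∷⟨ D⋖M ⟩ chain) nB nC
        with near-either (proj₂ (H-connected _ B (chain-start chain) maxB)) refl
      ... | inj₁ mB with chain-up chain mB nC
      ...   | M⪯B , C⪯D′ = ⊆-trans (proj₁ D⋖M) M⪯B , C⪯D′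
      chain-up (maxD ∷⟨ D⋖M ⟩ chain) nB nC | inj₂ mC with crossing maxD (inj₁ D⋖M) nB mC
      ...   | refl , refl = id , chain-⪯ chain

      -- The first step onto the side of `B` would climb from `C` to `B`.
      chain-not-down : ∀ {D D′} → Chain E D D′ → Near (_≡ C) D → ¬ Near (_≡ B) D′
      chain-not-down [ _ ] nC nB = near-disjoint nB nC
      chain-not-down (maxD ∷⟨ D⋖M ⟩ chain) nC nB
        with near-either (proj₂ (H-connected _ B (chain-start chain) maxB)) refl
      ... | inj₂ mC = chain-not-down chain mC nB
      ... | inj₁ mB with crossing (chain-start chain) (inj₂ D⋖M) mB nC
      ...   | refl , refl = cover-strict maxB maxC B⋖C (proj₁ D⋖M)

      Lower Upper : Vtx m n → Set
      Lower v = Near (_≡ B) (node v)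
      Upper v = Near (_≡ C) (node v)

      either : ∀ v → Lower v ⊎ Upper v
      either v = near-either (proj₂ (H-connected _ B (node-max v) maxB)) refl

      lower-X : ∀ {x} → x ∈ X B → Lower (inj₁ x)
      lower-X {x} x∈ with either (inj₁ x)
      ... | inj₁ l = l
      ... | inj₂ u = ⊥-elim (chain-not-down
        (⪯⇒chain (node-max (inj₁ x)) maxB (node-x-least maxB x∈)) u (near-refl maxB refl))

      upper-Y : ∀ {y} → y ∈ Y C → Upper (inj₂ y)
      upper-Y {y} y∈ with either (inj₂ y)
      ... | inj₂ u = u
      ... | inj₁ l = ⊥-elim (chain-not-down
        (⪯⇒chain maxC (node-max (inj₂ y)) (node-y-greatest maxC y∈)) (near-refl maxC refl) l)

      edge-up : ∀ {x y} → T (E x y) → Lower (inj₁ x) → Upper (inj₂ y) → x ∈ X B × y ∈ Y C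
      edge-up {x} {y} xy l u with chain-up (⪯⇒chain (node-max (inj₁ x)) (node-max (inj₂ y)) (edge⇒⪯ xy)) l u
      ... | x⪯B , C⪯y = x⪯B (x∈node x) , ⪯⇒Y⊇ maxC (node-max (inj₂ y)) C⪯y (y∈node y)

      edge-not-down : ∀ {x y} → T (E x y) → Upper (inj₁ x) → ¬ Lower (inj₂ y)
      edge-not-down {x} {y} xy =
        chain-not-down (⪯⇒chain (node-max (inj₁ x)) (node-max (inj₂ y)) (edge⇒⪯ xy))

    -- B is the ⪯-greatest biclique with shore Y(B) ⊇ {y, y₀}, so that a cover C of B below the
    -- biclique of y contains x and y but not y₀, while B does not contain x₂.
    separating-cover : ∀ {y₀ x y x₂} → T (E x y₀) → T (E x y) → T (E x₂ y) → ¬ T (E x₂ y₀) →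
      ∃[ B ] ∃[ C ] IsMaxBiclique E B × IsMaxBiclique E C × Covers E B C ×
        x ∈ X B × x₂ ∉ X B × y ∈ Y C × y₀ ∉ Y C
    separating-cover {y₀} {x} {y} {x₂} xy₀ xy x₂y ¬x₂y₀ =
      B , C , maxB , maxC , B⋖C , x∈B , x₂∉B , y∈C , y₀∉C
      where
      B : Bic m n
      B = closure E (⁅ y ⁆ ∪ ⁅ y₀ ⁆)
      ∈B : ∀ {u} → T (E u y) → T (E u y₀) → u ∈ X B
      ∈B uy uy₀ = common⁺ (λ y′ → [ singleton-elim uy y′ , singleton-elim uy₀ y′ ]′ ∘ x∈p∪q⁻ _ _)
      x∈B : x ∈ X B
      x∈B = ∈B xy xy₀
      maxB : IsMaxBiclique E B
      maxB = closure-max (y , x∈p∪q⁺ (inj₁ (x∈⁅x⁆ y))) (x , x∈B)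
      x₂∉B : x₂ ∉ X B
      x₂∉B x₂∈ = ¬x₂y₀ (common⁻ x₂∈ y₀ (x∈p∪q⁺ (inj₂ (x∈⁅x⁆ y₀))))
      cover : ∃[ C ] IsMaxBiclique E C × Covers E B C × C ⪯ node (inj₂ y)
      cover = chain-cover
        (⪯⇒chain maxB (node-max (inj₂ y))
          (node-y-greatest maxB (⊆comY∘comX (x∈p∪q⁺ (inj₁ (x∈⁅x⁆ y))))))
        -- The chain is nontrivial because `x₂` lies in the node of `y` but not in `B`.
        (λ B≡y → x₂∉B (subst (λ D → x₂ ∈ X D) (sym B≡y) (x∈node-y x₂y)))
      C : Bic m n
      C = proj₁ cover
      maxC : IsMaxBiclique E C
      maxC = proj₁ (proj₂ cover)
      B⋖C : Covers E B C
      B⋖C = proj₁ (proj₂ (proj₂ cover))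
      y∈C : y ∈ Y C
      y∈C = ⪯⇒Y⊇ maxC (node-max (inj₂ y)) (proj₂ (proj₂ (proj₂ cover))) (y∈node y)
      y₀∉C : y₀ ∉ Y C
      y₀∉C y₀∈ = cover-strict maxB maxC B⋖C (λ u∈ → ∈B (max-edge maxC u∈ y∈C) (max-edge maxC u∈ y₀∈))

    -- By `edge-up`, a crossing edge has its ends in X(B) and Y(C). As `y₀` is not in Y(C) and `x₂`
    -- not in X(B), the edges at the two ends of the path do not cross.
    split : ∀ a b c d → Adj E a b → Adj E b c → Adj E c d → ¬ Adj E a d → Split a b c d
    split (inj₂ y₀) (inj₁ x) (inj₂ y) (inj₁ x₂) xy₀ xy x₂y ¬x₂y₀
      with separating-cover xy₀ xy x₂y ¬x₂y₀
    ... | B , C , maxB , maxC , B⋖C , x∈ , x₂∉ , y∈ , y₀∉ = record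
      { L = Lower ; R = Upper ; either = either ; disjoint = near-disjoint
      ; left = lower-y₀ ; right = upper-x₂ ; cross = cross }
      where
      open CoverCut maxB maxC B⋖C
      lower-y₀ : Lower (inj₂ y₀)
      lower-y₀ with either (inj₂ y₀)
      ... | inj₁ l = l
      ... | inj₂ u = contradiction (proj₂ (edge-up xy₀ (lower-X x∈) u)) y₀∉
      upper-x₂ : Upper (inj₁ x₂)
      upper-x₂ with either (inj₁ x₂)
      ... | inj₂ u = u
      ... | inj₁ l = contradiction (proj₁ (edge-up x₂y l (upper-Y y∈))) x₂∉
      cross : ∀ v w → Adj E v w → Lower v → Upper w → Adj E v (inj₂ y) × Adj E (inj₁ x) w
      cross (inj₂ _)  (inj₁ _)  e l u = ⊥-elim (edge-not-down e u l)
      cross (inj₁ x′) (inj₂ y′) e l u with edge-up e l u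
      ... | x′∈ , y′∈ = max-edge maxB x′∈ (⪯⇒Y⊇ maxB maxC (proj₁ B⋖C) y∈) , max-edge maxC (proj₁ B⋖C x∈) y′∈
    -- The other colouring: reverse the path and exchange the sides.
    split (inj₁ x₂) (inj₂ y) (inj₁ x) (inj₂ y₀) x₂y xy xy₀ ¬x₂y₀ = record
      { L = R ; R = L ; either = [ inj₂ , inj₁ ]′ ∘ either ; disjoint = flip disjoint
      ; left = right ; right = left
      ; cross = λ v w e r l →
          let x~v , w~y = cross w v (adj-sym v w e) l r in adj-sym (inj₁ x) v w~y , adj-sym w (inj₂ y) x~v }
      where
      open Split (split (inj₂ y₀) (inj₁ x) (inj₂ y) (inj₁ x₂) xy₀ xy x₂y ¬x₂y₀)

    -- Distances in connected induced subgraphs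

    module _ (S : Vtx m n → Bool) where

      SWalk : Vtx m n → Vtx m n → ℕ → Set
      SWalk = Walk (InS S) (Adj E)

      isDist-tail : ∀ {u w v k} → T (S u) → Adj E u w → SWalk w v k → IsDist (InS S) (Adj E) u v (suc k) →
        IsDist (InS S) (Adj E) w v k
      isDist-tail u∈ e ws (_ , min) = ws , λ j ws′ → ≤-pred (min (suc j) (step u∈ e ws′))

      module _ {a b c d : Vtx m n} (sp : Split a b c d) where

        open Split sp

        -- Stepping from `p` back to the left would make `b` adjacent to `p`, and prefixing `b`
        -- would give too short a walk to `v`.
        stays-right : T (S b) → ∀ {p v k} → SWalk p v k →
          (∀ j → SWalk b v j → suc k < j) → R p → R v
        stays-right b∈ (here _) far Rp = Rp
        stays-right b∈ {p} (step {w = q} p∈ e ws) far Rp with either q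
        ... | inj₂ Rq = stays-right b∈ ws (λ j ws′ → ≤-trans (n≤1+n _) (far j ws′)) Rq
        ... | inj₁ Lq = contradiction
          (far _ (step b∈ (proj₂ (cross q p (adj-sym p q e) Lq Rp)) (step p∈ e ws))) (n≮n _)

        find-crossing : ∀ {u v l} → Walk All⊤ (Adj E) u v l → L u → R v →
          ∃[ w ] ∃[ w′ ] ∃[ i ] ∃[ j ] Walk All⊤ (Adj E) u w i × Walk All⊤ (Adj E) w′ v j ×
            Adj E w c × Adj E b w′ × l ≡ i + suc j
        find-crossing (here _) Lu Ru = ⊥-elim (disjoint Lu Ru)
        find-crossing {u} (step {w = q} _ e ws) Lu Rv with either q
        ... | inj₂ Rq = let uc , bq = cross u q e Lu Rq in
          _ , _ , _ , _ , here tt , ws , uc , bq , refl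
        ... | inj₁ Lq with find-crossing ws Lq Rv
        ...   | _ , _ , _ , _ , ws₁ , ws₂ , wc , bw′ , refl =
          _ , _ , _ , _ , step tt e ws₁ , ws₂ , wc , bw′ , refl

      GeodesicAt : ℕ → Set
      GeodesicAt k = ∀ {u v l} → IsDist (InS S) (Adj E) u v k → Walk All⊤ (Adj E) u v l → k ≤ l

      geodesic-step : ∀ {k} → GeodesicAt (suc (suc k)) → GeodesicAt (suc (suc (suc k)))
      geodesic-step {k} ih {a} {v}
        dist@(step {w = b} a∈ ab ws@(step {w = c} b∈ bc (step {w = d} c∈ cd wsd)) , min) walk
        with find-crossing sp walk left (stays-right sp b∈ wsd (proj₂ dist-b) right)
        where
        sp : Split a b c d
        -- A chord `a d` would shortcut the geodesic.
        sp = split a b c d ab bc cd (λ ad → n≮n _ (≤-trans (n≤1+n _) (min _ (step a∈ ad wsd))))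
        open Split sp
        dist-b : IsDist (InS S) (Adj E) b v (suc (suc k))
        dist-b = isDist-tail a∈ ab ws dist
      ... | _ , _ , zero  , _ , here _ , _   , ac , _   , _    = ⊥-elim (triangle-free a b c ab bc ac)
      ... | _ , _ , suc i , j , _      , ws₂ , _  , bw′ , refl =
        s≤s (≤-trans (ih (isDist-tail a∈ ab ws dist) (step tt bw′ ws₂)) (m≤n+m (suc j) i))

      -- A cut needs four path vertices, so distances up to two are settled directly: an edge of G
      -- between vertices of `S` is an edge in `S`.
      geodesic : ∀ k → GeodesicAt k
      geodesic zero _ _ = z≤n
      geodesic (suc k) (ws , min) (here _) = min 0 (here (walk-start ws))
      geodesic (suc zero) _ (step _ _ _) = s≤s z≤n
      geodesic (suc (suc zero)) (step u∈ _ (step _ _ (here v∈)) , min) (step _ e (here _)) =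
        min 1 (step u∈ e (here v∈))
      geodesic (suc (suc zero)) _ (step _ _ (step _ _ _)) = s≤s (s≤s z≤n)
      geodesic (suc (suc (suc k))) dist walk@(step _ _ _) = geodesic-step (geodesic (suc (suc k))) dist walk

    -- For the second implication, connectedness supplies a distance in `S`, which `geodesic`
    -- identifies with the one in G.
    acyclic⇒BDH : IsBDH E
    acyclic⇒BDH S S-connected u v u∈ v∈ d =
      (λ dist → walk-map (λ _ → tt) id (proj₁ dist) , λ _ → geodesic S d dist) ,
      λ (walk , min) →
        let d′ , ws , min′ = least (walk? (T? ∘ S) u v) (proj₂ (S-connected u v u∈ v∈))
            d′≡d = ≤-antisym (geodesic S d′ (ws , min′) walk) (min d′ (walk-map (λ _ → tt) id ws))
        in subst (IsDist (InS S) (Adj E) u v) d′≡d (ws , min′)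

-- If the opposite class is empty, the vertex is vacuously universal; otherwise a walk into that
-- class starts with an edge.
neighbours : ∀ {m n} {E : Fin m → Fin n → Bool} → GConnected E → ¬ HasUniversal E → ∀ v → ∃ (Adj E v)
neighbours {n = zero}  _    ¬univ (inj₁ x) = ⊥-elim (¬univ (inj₁ (x , λ ())))
neighbours {n = suc _} conn _     (inj₁ x) with conn (inj₁ x) (inj₂ Fin.zero) tt tt
... | _ , step {w = w} _ e _ = w , e
neighbours {m = zero}  _    ¬univ (inj₂ y) = ⊥-elim (¬univ (inj₂ (y , λ ())))
neighbours {m = suc _} conn _     (inj₂ y) with conn (inj₂ y) (inj₁ Fin.zero) tt tt
... | _ , step {w = w} _ e _ = w , e

theorem1 : ∀ {m n : ℕ} (E : Fin m → Fin n → Bool) →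
    (Fin m ⊎ Fin n) → GConnected E → ¬ HasUniversal E →
    (IsTree (IsMaxBiclique E) (HAdj E) ⇔ IsBDH E)
theorem1 E v conn ¬univ = mk⇔
  (λ (_ , _ , acyclic) → acyclic⇒BDH acyclic)
  (λ bdh → (node v , node-max v) , H-connected , BDH⇒acyclic conn bdh)
  where open Nodes (neighbours conn ¬univ) conn
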